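{- Let $\lambda$ be a nonzero real number and $n\ge2$ an integer. Then $$\sum_{k=2}^{n}(1)_{k-1,\frac{1}{\lambda}}\,\lambda^{k-2}\,S_{2,\lambda}(n,k)=(n-1)(1)_{n-1,\lambda}.$$
   Context: For real $y$, $\mu\neq 0$ and integer $k\ge0$: $(y)_{0,\mu}=1$, $(y)_{k,\mu}=y(y-\mu)\cdots(y-(k-1)\mu)$ (used with $\mu=\lambda$ and $\mu=1/\lambda$); $(y)_0=1$, $(y)_k=y(y-1)\cdots(y-k+1)$. The degenerate Stirling numbers of the second kind are defined by $(x)_{n,\lambda}=\sum_{k=0}^{n}S_{2,\lambda}(n,k)(x)_{k}$ ($n\ge0$); equivalently $\frac{1}{k!}(e_\lambda(t)-1)^k=\sum_{n\ge k}S_{2,\lambda}(n,k)\frac{t^n}{n!}$ with $e_\lambda(t)=(1+\lambda t)^{1/\lambda}$. -}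

module Defs where

open import Algebra.Bundles using (CommutativeRing)
open import Algebra.Structures using (IsCommutativeRing)
open import Data.Fin.Base using (Fin; toℕ; fromℕ; inject₁)
import Data.Fin.Properties as Fin
open import Data.Nat.Base as ℕ using (ℕ; zero; suc; _∸_; s≤s)
import Data.Nat.Properties as ℕ
open import Data.Product.Base using (∃-syntax; _×_; _,_)
open import Data.Rational.Base as ℚ using (ℚ; 0ℚ; 1ℚ; ½; ∣_∣; positive; nonNegative; ≢-nonZero)
import Data.Rational.Properties as ℚ
open import Data.Rational.Solver using (module +-*-Solver)
open import Level using (0ℓ; _⊔_)
open import Relation.Binary.PropositionalEquality as ≡ using (_≡_; _≢_; cong; cong₂; subst)
open import Relation.Nullary.Decidable using (yes; no)
open import Relation.Nullary.Negation using (contradiction)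

-- Real numbers: Cauchy sequences of rationals, with the setoid equality
-- "the difference tends to 0"

module Estimates where
  open import Data.Rational.Base using (_+_; _*_; _-_; _<_; _≤_)
  open +-*-Solver

  half : ∀ {ε} → 0ℚ < ε → 0ℚ < ε * ½
  half {ε} 0<ε = ℚ.*-monoˡ-<-pos ½ 0<ε

  half+half : ∀ ε → ε * ½ + ε * ½ ≡ ε
  half+half = solve 1 (λ e → e :* con ½ :+ e :* con ½ := e) ≡.refl

  split : ∀ {ε} p q → ∣ p ∣ < ε * ½ → ∣ q ∣ < ε * ½ → ∣ p + q ∣ < ε
  split {ε} p q p< q< = subst (∣ p + q ∣ <_) (half+half ε)
    (ℚ.≤-<-trans (ℚ.∣p+q∣≤∣p∣+∣q∣ p q) (ℚ.+-mono-< p< q<))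

  flip : ∀ p q → ∣ p - q ∣ ≡ ∣ q - p ∣
  flip p q = ≡.trans (≡.sym (ℚ.∣-p∣≡∣p∣ (p - q)))
    (cong ∣_∣ (solve 2 (λ p q → :- (p :- q) := q :- p) ≡.refl p q))

  chain : ∀ p q r → (p - q) + (q - r) ≡ p - r
  chain = solve 3 (λ p q r → (p :- q) :+ (q :- r) := p :- r) ≡.refl

  sum-diff : ∀ p q r s → (p - r) + (q - s) ≡ (p + q) - (r + s)
  sum-diff = solve 4 (λ p q r s → (p :- r) :+ (q :- s) := (p :+ q) :- (r :+ s)) ≡.refl

  neg-diff : ∀ p q → ∣ p - q ∣ ≡ ∣ (ℚ.- p) - (ℚ.- q) ∣
  neg-diff p q = ≡.trans (flip p q)
    (cong ∣_∣ (solve 2 (λ p q → q :- p := (:- p) :- (:- q)) ≡.refl p q))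

  prod-diff : ∀ p q r s → p * (q - s) + (p - r) * s ≡ p * q - r * s
  prod-diff = solve 4 (λ p q r s → p :* (q :- s) :+ (p :- r) :* s := p :* q :- r :* s) ≡.refl

  bound-step : ∀ p q → ∣ p - q ∣ < 1ℚ → ∣ p ∣ < 1ℚ + ∣ q ∣
  bound-step p q p-q< = ℚ.≤-<-trans
    (subst (λ z → ∣ z ∣ ≤ ∣ p - q ∣ + ∣ q ∣)
      (solve 2 (λ p q → (p :- q) :+ q := p) ≡.refl p q)
      (ℚ.∣p+q∣≤∣p∣+∣q∣ (p - q) q))
    (ℚ.+-monoˡ-< ∣ q ∣ p-q<)

  bound>0 : ∀ q → 0ℚ < 1ℚ + ∣ q ∣
  bound>0 q = ℚ.+-mono-<-≤ (ℚ.positive⁻¹ 1ℚ) (ℚ.0≤∣p∣ q)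

  0<* : ∀ {p q} → 0ℚ < p → 0ℚ < q → 0ℚ < p * q
  0<* {p} {q} 0<p 0<q = subst (_< p * q) (ℚ.*-zeroˡ q)
    (ℚ.*-monoˡ-<-pos q {{positive 0<q}} 0<p)

  shrink : ∀ {ε B} → 0ℚ < ε → 0ℚ < B → ∃[ δ ] (0ℚ < δ × B * δ ≡ ε)
  shrink {ε} {B} 0<ε 0<B = ℚ.1/ B * ε
    , 0<* (ℚ.positive⁻¹ (ℚ.1/ B) {{ℚ.1/pos⇒pos B}}) 0<ε
    , ≡.trans (≡.sym (ℚ.*-assoc B (ℚ.1/ B) ε))
        (≡.trans (cong (_* ε) (ℚ.*-inverseʳ B)) (ℚ.*-identityˡ ε))
    where instance
      pos-B = positive 0<B
      nz-B = ℚ.pos⇒nonZero B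

  mul-small : ∀ {p q B δ} → 0ℚ < B → ∣ p ∣ < B → ∣ q ∣ < δ → ∣ p * q ∣ < B * δ
  mul-small {p} {q} {B} {δ} 0<B p<B q<δ = subst (_< B * δ) (≡.sym (ℚ.∣p*q∣≡∣p∣*∣q∣ p q))
    (ℚ.≤-<-trans (ℚ.*-monoʳ-≤-nonNeg ∣ q ∣ {{nonNegative (ℚ.0≤∣p∣ q)}} (ℚ.<⇒≤ p<B))
                 (ℚ.*-monoʳ-<-pos B {{positive 0<B}} q<δ))

  recip : ℚ → ℚ
  recip q with q ℚ.≟ 0ℚ
  ... | yes _   = 0ℚ
  ... | no  q≢0 = ℚ.1/_ q {{≢-nonZero q≢0}}

  recip-inverse : ∀ {q} → q ≢ 0ℚ → q * recip q ≡ 1ℚ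
  recip-inverse {q} q≢0 with q ℚ.≟ 0ℚ
  ... | yes q≡0 = contradiction q≡0 q≢0
  ... | no  q≢0 = ℚ.*-inverseʳ q {{≢-nonZero q≢0}}

  nonzero : ∀ {e q} → 0ℚ < e → e ≤ ∣ q ∣ → q ≢ 0ℚ
  nonzero 0<e e≤ ≡.refl = ℚ.<-irrefl ≡.refl (ℚ.<-≤-trans 0<e e≤)

  recip-close : ∀ {e ε p q} → 0ℚ < e → 0ℚ < ε → e ≤ ∣ p ∣ → e ≤ ∣ q ∣ →
                ∣ q - p ∣ < ε * (e * e) → ∣ recip p - recip q ∣ < ε
  recip-close {e} {ε} {p} {q} 0<e 0<ε e≤p e≤q q-p< with ∣ recip p - recip q ∣ ℚ.<? ε
  ... | yes d<ε = d<ε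
  ... | no  d≮ε = contradiction
    (ℚ.<-≤-trans q-p<
      (ℚ.≤-trans (ℚ.*-monoʳ-≤-nonNeg (e * e) {{nonNegative (ℚ.<⇒≤ (0<* 0<e 0<e))}} (ℚ.≮⇒≥ d≮ε))
      (ℚ.≤-trans (ℚ.*-monoˡ-≤-nonNeg ∣ d ∣ {{nonNegative (ℚ.0≤∣p∣ d)}} ee≤)
                 (ℚ.≤-reflexive (≡.sym abs-eq)))))
    (ℚ.<-irrefl ≡.refl)
    where
    d = recip p - recip q

    ee≤ : e * e ≤ ∣ p ∣ * ∣ q ∣
    ee≤ = ℚ.≤-trans (ℚ.*-monoʳ-≤-nonNeg e {{nonNegative (ℚ.<⇒≤ 0<e)}} e≤p)
                    (ℚ.*-monoˡ-≤-nonNeg ∣ p ∣ {{nonNegative (ℚ.0≤∣p∣ p)}} e≤q)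

    eq : q - p ≡ d * (p * q)
    eq = ≡.trans
      (≡.sym (≡.trans
        (cong₂ (λ u v → u * q - v * p) (recip-inverse (nonzero 0<e e≤p)) (recip-inverse (nonzero 0<e e≤q)))
        (cong₂ _-_ (ℚ.*-identityˡ q) (ℚ.*-identityˡ p))))
      (solve 4 (λ p q a b → (p :* a) :* q :- (q :* b) :* p := (a :- b) :* (p :* q)) ≡.refl
        p q (recip p) (recip q))

    abs-eq : ∣ q - p ∣ ≡ ∣ d ∣ * (∣ p ∣ * ∣ q ∣)
    abs-eq = ≡.trans (cong ∣_∣ eq)
      (≡.trans (ℚ.∣p*q∣≡∣p∣*∣q∣ d (p * q)) (cong (∣ d ∣ *_) (ℚ.∣p*q∣≡∣p∣*∣q∣ p q)))

  left : ∀ {m n k} → m ℕ.⊔ n ℕ.≤ k → m ℕ.≤ k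
  left {m} {n} = ℕ.≤-trans (ℕ.m≤m⊔n m n)

  right : ∀ {m n k} → m ℕ.⊔ n ℕ.≤ k → n ℕ.≤ k
  right {m} {n} = ℕ.≤-trans (ℕ.m≤n⊔m m n)

open Estimates

IsCauchy : (ℕ → ℚ) → Set
IsCauchy s = ∀ ε → 0ℚ ℚ.< ε →
  ∃[ N ] (∀ m n → N ℕ.≤ m → N ℕ.≤ n → ∣ s m ℚ.- s n ∣ ℚ.< ε)

record ℝ : Set where
  constructor mkℝ
  field
    seq    : ℕ → ℚ
    cauchy : IsCauchy seq
open ℝ public

infix 4 _≈ᴿ_ _#ᴿ_
infixl 6 _+ᴿ_
infixl 7 _*ᴿ_

record _≈ᴿ_ (x y : ℝ) : Set where
  constructor mk≈
  field
    close : ∀ ε → 0ℚ ℚ.< ε → ∃[ N ] (∀ n → N ℕ.≤ n → ∣ seq x n ℚ.- seq y n ∣ ℚ.< ε)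
open _≈ᴿ_ public

-- Apartness, the positive form of x ≠ y that makes inversion computable;
-- classically equivalent to the negation of x ≈ᴿ y.
record _#ᴿ_ (x y : ℝ) : Set where
  constructor mk#
  field
    gap   : ℚ
    0<gap : 0ℚ ℚ.< gap
    from  : ℕ
    apart : ∀ n → from ℕ.≤ n → gap ℚ.≤ ∣ seq x n ℚ.- seq y n ∣
open _#ᴿ_ public

abstract
  const-cauchy : ∀ q → IsCauchy (λ _ → q)
  const-cauchy q = λ ε 0<ε → 0 , λ _ _ _ _ →
    subst (λ z → ∣ z ∣ ℚ.< ε) (≡.sym (ℚ.+-inverseʳ q)) 0<ε

fromℚ : ℚ → ℝ
fromℚ q = mkℝ (λ _ → q) (const-cauchy q)

0ᴿ 1ᴿ : ℝ
0ᴿ = fromℚ 0ℚ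
1ᴿ = fromℚ 1ℚ

abstract
  +-cauchy : ∀ x y → IsCauchy (λ n → seq x n ℚ.+ seq y n)
  +-cauchy x y = λ ε 0<ε →
    let M , p = cauchy x (ε ℚ.* ½) (half 0<ε)
        N , q = cauchy y (ε ℚ.* ½) (half 0<ε)
    in M ℕ.⊔ N , λ m n ≤m ≤n →
      subst (λ z → ∣ z ∣ ℚ.< ε) (sum-diff (seq x m) (seq y m) (seq x n) (seq y n))
        (split (seq x m ℚ.- seq x n) (seq y m ℚ.- seq y n)
          (p m n (left ≤m) (left ≤n)) (q m n (right {M} ≤m) (right {M} ≤n)))

_+ᴿ_ : ℝ → ℝ → ℝ
x +ᴿ y = mkℝ (λ n → seq x n ℚ.+ seq y n) (+-cauchy x y)

abstract
  neg-cauchy : ∀ x → IsCauchy (λ n → ℚ.- seq x n)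
  neg-cauchy x = λ ε 0<ε →
    let N , p = cauchy x ε 0<ε
    in N , λ m n ≤m ≤n → subst (ℚ._< ε) (neg-diff (seq x m) (seq x n)) (p m n ≤m ≤n)

-ᴿ_ : ℝ → ℝ
-ᴿ x = mkℝ (λ n → ℚ.- seq x n) (neg-cauchy x)

bounded : (x : ℝ) → ∃[ B ] (0ℚ ℚ.< B × ∃[ N ] (∀ n → N ℕ.≤ n → ∣ seq x n ∣ ℚ.< B))
bounded x =
  let N , p = cauchy x 1ℚ (ℚ.positive⁻¹ 1ℚ)
  in 1ℚ ℚ.+ ∣ seq x N ∣ , bound>0 (seq x N) , N , λ n ≤n →
    bound-step (seq x n) (seq x N) (p n N ≤n ℕ.≤-refl)

abstract
  *-cauchy : ∀ x y → IsCauchy (λ n → seq x n ℚ.* seq y n)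
  *-cauchy x y = λ ε 0<ε →
    let B , 0<B , K , bx = bounded x
        C , 0<C , L , by = bounded y
        δ , 0<δ , Bδ = shrink (half 0<ε) 0<B
        η , 0<η , Cη = shrink (half 0<ε) 0<C
        M , p = cauchy y δ 0<δ
        N , q = cauchy x η 0<η
    in (K ℕ.⊔ L) ℕ.⊔ (M ℕ.⊔ N) , λ m n ≤m ≤n →
      let xm = seq x m; xn = seq x n; ym = seq y m; yn = seq y n in
      subst (λ z → ∣ z ∣ ℚ.< ε) (prod-diff xm ym xn yn)
        (split (xm ℚ.* (ym ℚ.- yn)) ((xm ℚ.- xn) ℚ.* yn)
          (subst (∣ xm ℚ.* (ym ℚ.- yn) ∣ ℚ.<_) Bδ
            (mul-small 0<B (bx m (left {K} (left ≤m)))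
              (p m n (left {M} (right {K ℕ.⊔ L} ≤m)) (left {M} (right {K ℕ.⊔ L} ≤n)))))
          (subst (ℚ._< ε ℚ.* ½) (cong ∣_∣ (ℚ.*-comm yn (xm ℚ.- xn)))
            (subst (∣ yn ℚ.* (xm ℚ.- xn) ∣ ℚ.<_) Cη
              (mul-small 0<C (by n (right {K} (left ≤n)))
                (q m n (right {M} (right {K ℕ.⊔ L} ≤m)) (right {M} (right {K ℕ.⊔ L} ≤n)))))))

_*ᴿ_ : ℝ → ℝ → ℝ
x *ᴿ y = mkℝ (λ n → seq x n ℚ.* seq y n) (*-cauchy x y)

private
  apart₀ : ∀ {x} (x#0 : x #ᴿ 0ᴿ) n → from x#0 ℕ.≤ n → gap x#0 ℚ.≤ ∣ seq x n ∣
  apart₀ {x} x#0 n ≤n =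
    subst (λ z → gap x#0 ℚ.≤ ∣ z ∣) (ℚ.+-identityʳ (seq x n)) (apart x#0 n ≤n)

abstract
  inv-cauchy : ∀ x (x#0 : x #ᴿ 0ᴿ) → IsCauchy (λ n → recip (seq x n))
  inv-cauchy x x#0 = λ ε 0<ε →
    let e = gap x#0
        N , p = cauchy x (ε ℚ.* (e ℚ.* e)) (0<* 0<ε (0<* (0<gap x#0) (0<gap x#0)))
    in from x#0 ℕ.⊔ N , λ m n ≤m ≤n →
      recip-close (0<gap x#0) 0<ε (apart₀ x#0 m (left ≤m)) (apart₀ x#0 n (left ≤n))
        (p n m (right {from x#0} ≤n) (right {from x#0} ≤m))

-- recip is the reciprocal on ℚ, with the junk value recip 0ℚ = 0ℚ, which
-- apartness from 0 allows in finitely many places only.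
inv : (x : ℝ) → x #ᴿ 0ᴿ → ℝ
inv x x#0 = mkℝ (λ n → recip (seq x n)) (inv-cauchy x x#0)

pointwise : ∀ {x y} → (∀ n → seq x n ≡ seq y n) → x ≈ᴿ y
pointwise {x} {y} eq = mk≈ λ ε 0<ε → 0 , λ n _ →
  subst (λ z → ∣ z ∣ ℚ.< ε)
    (≡.sym (≡.trans (cong (ℚ._- seq y n) (eq n)) (ℚ.+-inverseʳ (seq y n)))) 0<ε

≈ᴿ-sym : ∀ {x y} → x ≈ᴿ y → y ≈ᴿ x
≈ᴿ-sym {x} {y} x≈y = mk≈ λ ε 0<ε →
  let N , p = close x≈y ε 0<ε
  in N , λ n ≤n → subst (ℚ._< ε) (flip (seq x n) (seq y n)) (p n ≤n)

≈ᴿ-trans : ∀ {x y z} → x ≈ᴿ y → y ≈ᴿ z → x ≈ᴿ z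
≈ᴿ-trans {x} {y} {z} x≈y y≈z = mk≈ λ ε 0<ε →
  let M , p = close x≈y (ε ℚ.* ½) (half 0<ε)
      N , q = close y≈z (ε ℚ.* ½) (half 0<ε)
  in M ℕ.⊔ N , λ n ≤n →
    subst (λ z → ∣ z ∣ ℚ.< ε) (chain (seq x n) (seq y n) (seq z n))
      (split (seq x n ℚ.- seq y n) (seq y n ℚ.- seq z n) (p n (left ≤n)) (q n (right {M} ≤n)))

+-congᴿ : ∀ {x x′ y y′} → x ≈ᴿ x′ → y ≈ᴿ y′ → x +ᴿ y ≈ᴿ x′ +ᴿ y′
+-congᴿ {x} {x′} {y} {y′} x≈ y≈ = mk≈ λ ε 0<ε →
  let M , p = close x≈ (ε ℚ.* ½) (half 0<ε)
      N , q = close y≈ (ε ℚ.* ½) (half 0<ε)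
  in M ℕ.⊔ N , λ n ≤n →
    subst (λ z → ∣ z ∣ ℚ.< ε) (sum-diff (seq x n) (seq y n) (seq x′ n) (seq y′ n))
      (split (seq x n ℚ.- seq x′ n) (seq y n ℚ.- seq y′ n) (p n (left ≤n)) (q n (right {M} ≤n)))

neg-congᴿ : ∀ {x y} → x ≈ᴿ y → -ᴿ x ≈ᴿ -ᴿ y
neg-congᴿ {x} {y} x≈y = mk≈ λ ε 0<ε →
  let N , p = close x≈y ε 0<ε
  in N , λ n ≤n → subst (ℚ._< ε) (neg-diff (seq x n) (seq y n)) (p n ≤n)

*-congᴿ : ∀ {x x′ y y′} → x ≈ᴿ x′ → y ≈ᴿ y′ → x *ᴿ y ≈ᴿ x′ *ᴿ y′
*-congᴿ {x} {x′} {y} {y′} x≈ y≈ = mk≈ λ ε 0<ε →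
  let B , 0<B , K , bx = bounded x
      C , 0<C , L , by = bounded y′
      δ , 0<δ , Bδ = shrink (half 0<ε) 0<B
      η , 0<η , Cη = shrink (half 0<ε) 0<C
      M , p = close y≈ δ 0<δ
      N , q = close x≈ η 0<η
  in (K ℕ.⊔ L) ℕ.⊔ (M ℕ.⊔ N) , λ n ≤n →
    let a = seq x n; a′ = seq x′ n; b = seq y n; b′ = seq y′ n in
    subst (λ z → ∣ z ∣ ℚ.< ε) (prod-diff a b a′ b′)
      (split (a ℚ.* (b ℚ.- b′)) ((a ℚ.- a′) ℚ.* b′)
        (subst (∣ a ℚ.* (b ℚ.- b′) ∣ ℚ.<_) Bδ
          (mul-small 0<B (bx n (left {K} (left ≤n))) (p n (left {M} (right {K ℕ.⊔ L} ≤n)))))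
        (subst (ℚ._< ε ℚ.* ½) (cong ∣_∣ (ℚ.*-comm b′ (a ℚ.- a′)))
          (subst (∣ b′ ℚ.* (a ℚ.- a′) ∣ ℚ.<_) Cη
            (mul-small 0<C (by n (right {K} (left ≤n))) (q n (right {M} (right {K ℕ.⊔ L} ≤n)))))))

ℝ-isCommutativeRing : IsCommutativeRing _≈ᴿ_ _+ᴿ_ _*ᴿ_ -ᴿ_ 0ᴿ 1ᴿ
ℝ-isCommutativeRing = record
  { isRing = record
    { +-isAbelianGroup = record
      { isGroup = record
        { isMonoid = record
          { isSemigroup = record
            { isMagma = record
              { isEquivalence = record
                { refl = pointwise λ _ → ≡.refl
                ; sym = ≈ᴿ-sym
                ; trans = ≈ᴿ-trans
                }
              ; ∙-cong = +-congᴿ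
              }
            ; assoc = λ x y z → pointwise λ n → ℚ.+-assoc (seq x n) (seq y n) (seq z n)
            }
          ; identity = (λ x → pointwise λ n → ℚ.+-identityˡ (seq x n))
                     , (λ x → pointwise λ n → ℚ.+-identityʳ (seq x n))
          }
        ; inverse = (λ x → pointwise λ n → ℚ.+-inverseˡ (seq x n))
                  , (λ x → pointwise λ n → ℚ.+-inverseʳ (seq x n))
        ; ⁻¹-cong = neg-congᴿ
        }
      ; comm = λ x y → pointwise λ n → ℚ.+-comm (seq x n) (seq y n)
      }
    ; *-cong = *-congᴿ
    ; *-assoc = λ x y z → pointwise λ n → ℚ.*-assoc (seq x n) (seq y n) (seq z n)
    ; *-identity = (λ x → pointwise λ n → ℚ.*-identityˡ (seq x n))
                 , (λ x → pointwise λ n → ℚ.*-identityʳ (seq x n))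
    ; distrib = (λ x y z → pointwise λ n → ℚ.*-distribˡ-+ (seq x n) (seq y n) (seq z n))
              , (λ x y z → pointwise λ n → ℚ.*-distribʳ-+ (seq x n) (seq y n) (seq z n))
    }
  ; *-comm = λ x y → pointwise λ n → ℚ.*-comm (seq x n) (seq y n)
  }

ℝ-commutativeRing : CommutativeRing 0ℓ 0ℓ
ℝ-commutativeRing = record { isCommutativeRing = ℝ-isCommutativeRing }

*-inv : (x : ℝ) (x#0 : x #ᴿ 0ᴿ) → x *ᴿ inv x x#0 ≈ᴿ 1ᴿ
*-inv x x#0 = mk≈ λ ε 0<ε → from x#0 , λ n ≤n →
  subst (λ z → ∣ z ℚ.- 1ℚ ∣ ℚ.< ε)
    (≡.sym (recip-inverse (nonzero (0<gap x#0) (apart₀ x#0 n ≤n)))) 0<ε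

module Degenerate {c ℓ} (R : CommutativeRing c ℓ) where
  open CommutativeRing R
  open import Algebra.Properties.CommutativeSemiring.Exp commutativeSemiring public using (_^_)
  open import Algebra.Properties.Semiring.Mult semiring public using () renaming (_×_ to _·_)
  open import Algebra.Properties.Semiring.Sum semiring using (sum; sum-cong-≋; sum-init-last; ∑-distrib-+; *-distribʳ-sum)

  -- f a + f (a + 1) + ⋯ + f b, which is 0 when b < a.
  ∑ : ℕ → ℕ → (ℕ → Carrier) → Carrier
  ∑ a b f = sum {suc b ∸ a} λ i → f (a ℕ.+ toℕ i)

  syntax ∑ a b (λ k → t) = ∑[ k from a to b ] t

  -- (y)_{k,μ} = y (y - μ) ⋯ (y - (k - 1) μ)
  falling : Carrier → ℕ → Carrier → Carrier
  falling y zero    μ = 1#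
  falling y (suc k) μ = falling y k μ * (y - k · μ)

  syntax falling y k μ = ⦅ y ⦆[ k , μ ]

  IsDegenerateStirling₂ : Carrier → (ℕ → ℕ → Carrier) → Set (c ⊔ ℓ)
  IsDegenerateStirling₂ lam S = ∀ n x →
    ⦅ x ⦆[ n , lam ] ≈ ∑[ k from 0 to n ] (S n k * ⦅ x ⦆[ k , 1# ])

  -- Numbers satisfying the defining relation exist, by the recurrence
  -- S(n+1,k) = S(n,k-1) + (k - nλ) S(n,k).
  stirling : Carrier → ℕ → ℕ → Carrier
  stirling lam zero    zero    = 1#
  stirling lam zero    (suc k) = 0#
  stirling lam (suc n) zero    = (0 · 1# - n · lam) * stirling lam n 0
  stirling lam (suc n) (suc k) = stirling lam n k + (suc k · 1# - n · lam) * stirling lam n (suc k)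

  private
    open import Relation.Binary.Reasoning.Setoid setoid
    open import Algebra.Solver.Ring.NaturalCoefficients.Default commutativeSemiring

    stirling-above : ∀ lam n k → n ℕ.< k → stirling lam n k ≈ 0#
    stirling-above lam zero    (suc k) _ = refl
    stirling-above lam (suc n) (suc k) (s≤s n<k) = trans
      (+-cong (stirling-above lam n k n<k)
        (trans (*-congˡ (stirling-above lam n (suc k) (ℕ.m<n⇒m<1+n n<k))) (zeroʳ _)))
      (+-identityˡ 0#)

    step : ∀ s f x k l → (s * f) * (x - l) ≈ s * (f * (x - k)) + ((k - l) * s) * f
    step s f x k l = begin
      (s * f) * (x - l)                               ≈⟨ +-identityʳ _ ⟨
      (s * f) * (x - l) + 0#                          ≈⟨ +-congˡ (zeroʳ _) ⟨
      (s * f) * (x - l) + (s * f) * 0#                ≈⟨ +-congˡ (*-congˡ (-‿inverseˡ k)) ⟨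
      (s * f) * (x - l) + (s * f) * (- k + k)
        ≈⟨ solve 6 (λ s f x k k′ l′ → (s :* f) :* (x :+ l′) :+ (s :* f) :* (k′ :+ k)
             := s :* (f :* (x :+ k′)) :+ ((k :+ l′) :* s) :* f) refl s f x k (- k) (- l) ⟩
      s * (f * (x - k)) + ((k - l) * s) * f           ∎

  stirling-isDegenerateStirling₂ : ∀ lam → IsDegenerateStirling₂ lam (stirling lam)
  stirling-isDegenerateStirling₂ lam zero    x = sym (trans (+-identityʳ _) (*-identityʳ 1#))
  stirling-isDegenerateStirling₂ lam (suc n) x = begin
    falling x n lam * (x - n · lam)
      ≈⟨ *-congʳ (stirling-isDegenerateStirling₂ lam n x) ⟩
    sum (λ i → S (t i) * F (t i)) * (x - n · lam)
      ≈⟨ *-distribʳ-sum (x - n · lam) (λ (i : Fin (suc n)) → S (t i) * F (t i)) ⟩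
    sum (λ i → (S (t i) * F (t i)) * (x - n · lam))
      ≈⟨ sum-cong-≋ {suc n} (λ i → step (S (t i)) (F (t i)) x (t i · 1#) (n · lam)) ⟩
    sum (λ i → a (t i) + b (t i))
      ≈⟨ ∑-distrib-+ {suc n} (λ i → a (t i)) (λ i → b (t i)) ⟩
    sum (λ i → a (t i)) + sum (λ i → b (t i))
      ≈⟨ +-congˡ shift ⟩
    sum (λ i → a (t i)) + (b 0 + sum (λ i → b (suc (t i))))
      ≈⟨ solve 3 (λ u v w → u :+ (v :+ w) := v :+ (u :+ w)) refl _ _ _ ⟩
    b 0 + (sum (λ i → a (t i)) + sum (λ i → b (suc (t i))))
      ≈⟨ +-congˡ (∑-distrib-+ {suc n} (λ i → a (t i)) (λ i → b (suc (t i)))) ⟨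
    b 0 + sum (λ i → a (t i) + b (suc (t i)))
      ≈⟨ +-congˡ (sum-cong-≋ {suc n} λ i → sym (distribʳ (F (suc (t i))) (S (t i)) ((suc (t i) · 1# - n · lam) * S (suc (t i))))) ⟩
    b 0 + sum (λ i → stirling lam (suc n) (suc (t i)) * F (suc (t i))) ∎
    where
    t : Fin (suc n) → ℕ
    t = toℕ
    S = stirling lam n
    F : ℕ → Carrier
    F k = falling x k 1#
    a b : ℕ → Carrier
    a k = S k * F (suc k)
    b k = ((k · 1# - n · lam) * S k) * F k

    b-last : b (suc n) ≈ 0#
    b-last = trans (*-congʳ (trans (*-congˡ (stirling-above lam n (suc n) ℕ.≤-refl)) (zeroʳ _))) (zeroˡ _)

    shift : sum (λ i → b (t i)) ≈ b 0 + sum (λ i → b (suc (t i)))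
    shift = begin
      sum (λ i → b (t i))
        ≈⟨ sum-cong-≋ {suc n} (λ i → reflexive (cong b (≡.sym (Fin.toℕ-inject₁ i)))) ⟩
      sum (λ (i : Fin (suc n)) → b (toℕ (inject₁ i)))
        ≈⟨ +-identityʳ _ ⟨
      sum (λ (i : Fin (suc n)) → b (toℕ (inject₁ i))) + 0#
        ≈⟨ +-congˡ (trans (reflexive (cong b (Fin.toℕ-fromℕ (suc n)))) b-last) ⟨
      sum (λ (i : Fin (suc n)) → b (toℕ (inject₁ i))) + b (toℕ (fromℕ (suc n)))
        ≈⟨ sum-init-last {suc n} (λ i → b (toℕ i)) ⟨
      sum {suc (suc n)} (λ i → b (toℕ i)) ∎

open Degenerate ℝ-commutativeRing public

{-# OPTIONS --safe #-}

-- For n ≥ 1 one may divide the defining relation by x: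
--   Σ_{k≥1} S(n,k) (x-1)_{k-1} = (x-λ)(x-2λ)⋯(x-(n-1)λ).
-- At x = λ+1 the right side is (1)_{n-1,λ}.  The k = 1 term on the left is
-- S(n,1) = (1)_{n-1,λ} (1-(n-1)λ), and for k ≥ 2 one has
-- (λ)_{k-1} = λ · (1)_{k-1,1/λ} λ^{k-2}; cancelling λ gives the theorem.
-- Since λ+1 need not be invertible, the division by x is justified through
-- the recurrence for S, which holds because the falling factorials are
-- linearly independent as functions on ℕ.

module Submission where

open import Algebra.Bundles using (CommutativeRing)
open import Data.Fin.Base using (Fin; zero; suc; toℕ)
open import Data.Nat.Base as ℕ using (ℕ; zero; suc; s≤s)
import Data.Nat.Properties as ℕ
import Data.Rational.Base as ℚ
import Data.Rational.Properties as ℚ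
open import Function.Base using (_∘_)
open import Level using (_⊔_)
import Relation.Binary.PropositionalEquality as ≡

-- Identities in a commutative ring.

module RingIdentities {c ℓ} (R : CommutativeRing c ℓ) where
  open CommutativeRing R
  open import Algebra.Properties.Ring ring using (-‿+-comm; -‿distribʳ-*)
  open import Algebra.Solver.Ring.NaturalCoefficients.Default commutativeSemiring
  open import Relation.Binary.Reasoning.Setoid setoid

  +-x*0# : ∀ a x → a + x * 0# ≈ a
  +-x*0# a x = trans (+-congˡ (zeroʳ x)) (+-identityʳ a)

  shift-factor : ∀ x f k → x * f * (x - (1# + k)) ≈ x * (f * (x - 1# - k))
  shift-factor x f k = begin
    x * f * (x - (1# + k))      ≈⟨ *-congˡ (+-congˡ (-‿+-comm 1# k)) ⟨
    x * f * (x + (- 1# - k))    ≈⟨ solve 4 (λ x f i k′ → x :* f :* (x :+ (i :+ k′)) := x :* (f :* (x :+ i :+ k′)))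
                                     refl x f (- 1#) (- k) ⟩
    x * (f * (x - 1# - k))      ∎

  pull-out : ∀ d x f → d * (x * f) ≈ x * (d * f)
  pull-out = solve 3 (λ d x f → d :* (x :* f) := x :* (d :* f)) refl

  -- The coefficients of `g * f` add up to (l - k) + (1 + k - l - m) = 1 - m. Since `k` cancels,
  -- every term of the sum in `stirling-divided` acquires the same factor, which can then be taken
  -- out.
  collect : ∀ g f l k m →
    g * (f * (l - k)) + (1# + k - (l + m)) * g * f ≈ g * f * (1# - m)
  collect g f l k m = begin
    g * (f * (l - k)) + (1# + k - (l + m)) * g * f
      ≈⟨ +-congˡ (*-congʳ (*-congʳ (+-congˡ (-‿+-comm l m)))) ⟨
    g * (f * (l - k)) + (1# + k + (- l - m)) * g * f
      ≈⟨ solve 8 (λ g f l l′ k k′ m′ i →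
           g :* (f :* (l :+ k′)) :+ (i :+ k :+ (l′ :+ m′)) :* g :* f
           := g :* f :* (i :+ m′) :+ g :* f :* ((l :+ l′) :+ (k :+ k′)))
           refl g f l (- l) k (- k) (- m) 1# ⟩
    g * f * (1# - m) + g * f * ((l - l) + (k - k))
      ≈⟨ +-congˡ (*-congˡ (trans (+-cong (-‿inverseʳ l) (-‿inverseʳ k)) (+-identityʳ 0#))) ⟩
    g * f * (1# - m) + g * f * 0#
      ≈⟨ +-x*0# _ _ ⟩
    g * f * (1# - m) ∎

  rescale : ∀ f p l m → f * (1# - m) * (l * p) ≈ f * p * (l - l * m)
  rescale f p l m = begin
    f * (1# - m) * (l * p)      ≈⟨ solve 4 (λ f p l m′ → f :* (con 1 :+ m′) :* (l :* p) := f :* p :* (l :+ l :* m′))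
                                     refl f p l (- m) ⟩
    f * p * (l + l * - m)       ≈⟨ *-congˡ (+-congˡ (-‿distribʳ-* l m)) ⟨
    f * p * (l - l * m)         ∎

  split-off : ∀ f m → f ≈ f * (1# - m) + m * f
  split-off f m = begin
    f                           ≈⟨ +-x*0# f f ⟨
    f + f * 0#                  ≈⟨ +-congˡ (*-congˡ (-‿inverseˡ m)) ⟨
    f + f * (- m + m)           ≈⟨ solve 3 (λ f m m′ → f :+ f :* (m′ :+ m) := f :* (con 1 :+ m′) :+ m :* f)
                                     refl f m (- m) ⟩
    f * (1# - m) + m * f        ∎

  regroup : ∀ a p l s → l * (a * p * s) ≈ s * (a * (l * p))
  regroup = solve 4 (λ a p l s → l :* (a :* p :* s) := s :* (a :* (l :* p))) refl

module DegenerateProperties {c ℓ} (R : CommutativeRing c ℓ) where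
  open import Defs using (module Degenerate)
  open CommutativeRing R
  open Degenerate R
  open import Algebra.Properties.AbelianGroup +-abelianGroup using (xyx⁻¹≈y)
  open import Algebra.Properties.Ring ring using (+-cancelˡ; -0#≈0#)
  open import Algebra.Properties.Semiring.Sum semiring
    using (sum; sum-cong-≋; ∑-distrib-+; *-distribˡ-sum; *-distribʳ-sum)
  open import Relation.Binary.Reasoning.Setoid setoid

  open RingIdentities R

  -- Falling factorials and padded sums.

  falling-cong : ∀ {x y} k μ → x ≈ y → ⦅ x ⦆[ k , μ ] ≈ ⦅ y ⦆[ k , μ ]
  falling-cong zero    μ x≈y = refl
  falling-cong (suc k) μ x≈y = *-cong (falling-cong k μ x≈y) (+-congʳ x≈y)

  -- `falling` grows at its last factor, whereas the argument in `newton-unique` splits off the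
  -- first; induction passes from one to the other.
  falling-suc : ∀ x k → ⦅ x ⦆[ suc k , 1# ] ≈ x * ⦅ x - 1# ⦆[ k , 1# ]
  falling-suc x zero = begin
    1# * (x - 0#)  ≈⟨ *-identityˡ _ ⟩
    x - 0#         ≈⟨ +-congˡ -0#≈0# ⟩
    x + 0#         ≈⟨ +-identityʳ x ⟩
    x              ≈⟨ *-identityʳ x ⟨
    x * 1#         ∎
  falling-suc x (suc k) = trans (*-congʳ (falling-suc x k)) (shift-factor x _ (k · 1#))

  sum-extend : ∀ n (b : ℕ → Carrier) → b n ≈ 0# → sum {suc n} (b ∘ toℕ) ≈ sum {n} (b ∘ toℕ)
  sum-extend zero    b bₙ≈0 = trans (+-identityʳ _) bₙ≈0
  sum-extend (suc n) b bₙ≈0 = +-congˡ (sum-extend n (b ∘ suc) bₙ≈0)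

  -- The numbers given by the recurrence.

  stirling-above : ∀ lam n k → n ℕ.< k → stirling lam n k ≈ 0#
  stirling-above lam zero    (suc k) _ = refl
  stirling-above lam (suc n) (suc k) (s≤s n<k) = trans
    (+-cong (stirling-above lam n k n<k)
      (trans (*-congˡ (stirling-above lam n (suc k) (ℕ.m<n⇒m<1+n n<k))) (zeroʳ _)))
    (+-identityˡ 0#)

  stirling-zero : ∀ lam n → stirling lam (suc n) 0 ≈ 0#
  stirling-zero lam zero    = trans (*-congʳ (-‿inverseʳ 0#)) (zeroˡ _)
  stirling-zero lam (suc n) = trans (*-congˡ (stirling-zero lam n)) (zeroʳ _)

  -- Column 0 vanishes past the first row, so in column 1 the recurrence becomes that of `falling`.
  stirling-one : ∀ lam n → stirling lam (suc n) 1 ≈ ⦅ 1# ⦆[ suc n , lam ]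
  stirling-one lam zero = begin
    1# + (1# + 0# - 0#) * 0#  ≈⟨ +-congˡ (zeroʳ _) ⟩
    1# + 0#                   ≈⟨ +-congˡ (-‿inverseʳ 0#) ⟨
    1# + (0# - 0#)            ≈⟨ +-assoc 1# 0# (- 0#) ⟨
    1# + 0# - 0#              ≈⟨ +-congʳ (+-identityʳ 1#) ⟩
    1# - 0#                   ≈⟨ *-identityˡ _ ⟨
    1# * (1# - 0#)            ∎
  stirling-one lam (suc n) = begin
    stirling lam (suc n) 0 + (1# + 0# - suc n · lam) * stirling lam (suc n) 1
      ≈⟨ +-cong (stirling-zero lam n) (*-cong (+-congʳ (+-identityʳ 1#)) (stirling-one lam n)) ⟩
    0# + (1# - suc n · lam) * ⦅ 1# ⦆[ suc n , lam ]
      ≈⟨ trans (+-identityˡ _) (*-comm _ _) ⟩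
    ⦅ 1# ⦆[ suc (suc n) , lam ] ∎

  -- The index `i` stands for k - 1, and `lam` is x - 1 at x = λ + 1. Induction on `n` through the
  -- recurrence replaces the division by x.
  stirling-divided : ∀ lam n →
    sum {suc n} (λ i → stirling lam (suc n) (suc (toℕ i)) * ⦅ lam ⦆[ toℕ i , 1# ]) ≈ ⦅ 1# ⦆[ n , lam ]
  stirling-divided lam zero = begin
    stirling lam 1 1 * 1# + 0#  ≈⟨ trans (+-identityʳ _) (*-identityʳ _) ⟩
    1# + (1# + 0# - 0#) * 0#    ≈⟨ +-congˡ (zeroʳ _) ⟩
    1# + 0#                     ≈⟨ +-identityʳ 1# ⟩
    1#                          ∎
  stirling-divided lam (suc n) = begin
    sum {suc (suc n)} (λ i → stirling lam (suc (suc n)) (suc (toℕ i)) * F (toℕ i))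
      ≈⟨ sum-cong-≋ {suc (suc n)} (λ i → distribʳ (F (toℕ i)) (S (toℕ i)) ((suc (toℕ i) · 1# - suc n · lam) * S (suc (toℕ i)))) ⟩
    sum {suc (suc n)} (λ i → a (toℕ i) + b (toℕ i))
      ≈⟨ ∑-distrib-+ {suc (suc n)} (a ∘ toℕ) (b ∘ toℕ) ⟩
    sum {suc (suc n)} (a ∘ toℕ) + sum {suc (suc n)} (b ∘ toℕ)
      -- The first term of `a` contains S(n+1,0) = 0 and the last term of `b` contains S(n+1,n+2) =
      -- 0. Without them both sums have `suc n` terms, and the shifted `a` involves the same
      -- S(n+1,i+1) as `b`.
      ≈⟨ +-cong (trans (+-congʳ a₀) (+-identityˡ _)) (sum-extend (suc n) b b-last) ⟩
    sum {suc n} (a ∘ suc ∘ toℕ) + sum {suc n} (b ∘ toℕ)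
      ≈⟨ ∑-distrib-+ {suc n} (a ∘ suc ∘ toℕ) (b ∘ toℕ) ⟨
    sum {suc n} (λ i → a (suc (toℕ i)) + b (toℕ i))
      ≈⟨ sum-cong-≋ {suc n} (λ i → collect (S (suc (toℕ i))) (F (toℕ i)) lam (toℕ i · 1#) (n · lam)) ⟩
    sum {suc n} (λ i → S (suc (toℕ i)) * F (toℕ i) * (1# - n · lam))
      ≈⟨ *-distribʳ-sum {suc n} (1# - n · lam) (λ i → S (suc (toℕ i)) * F (toℕ i)) ⟨
    sum {suc n} (λ i → S (suc (toℕ i)) * F (toℕ i)) * (1# - n · lam)
      ≈⟨ *-congʳ (stirling-divided lam n) ⟩
    ⦅ 1# ⦆[ suc n , lam ] ∎
    where
    S F a b : ℕ → Carrier
    S = stirling lam (suc n)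
    F k = ⦅ lam ⦆[ k , 1# ]
    a k = S k * F k
    b k = (suc k · 1# - suc n · lam) * S (suc k) * F k

    a₀ : a 0 ≈ 0#
    a₀ = trans (*-congʳ (stirling-zero lam n)) (zeroˡ _)

    b-last : b (suc n) ≈ 0#
    b-last = trans (*-congʳ (trans (*-congˡ (stirling-above lam (suc n) (suc (suc n)) ℕ.≤-refl)) (zeroʳ _))) (zeroˡ _)

  -- By `stirling-one`, the k = 1 term of `stirling-divided` is the whole value times 1 - (n+1)λ, so
  -- the remaining terms make up the value times (n+1)λ.
  stirling-tail : ∀ lam n →
    sum {suc n} (λ i → stirling lam (suc (suc n)) (suc (suc (toℕ i))) * ⦅ lam ⦆[ suc (toℕ i) , 1# ])
      ≈ (suc n · lam) * ⦅ 1# ⦆[ suc n , lam ]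
  stirling-tail lam n = +-cancelˡ _ _ _ (begin
    stirling lam (suc (suc n)) 1 * 1# + _  ≈⟨ stirling-divided lam (suc n) ⟩
    ⦅ 1# ⦆[ suc n , lam ]                   ≈⟨ split-off _ (suc n · lam) ⟩
    ⦅ 1# ⦆[ suc (suc n) , lam ] + (suc n · lam) * ⦅ 1# ⦆[ suc n , lam ]
      ≈⟨ +-congʳ (trans (*-identityʳ _) (stirling-one lam (suc n))) ⟨
    stirling lam (suc (suc n)) 1 * 1# + (suc n · lam) * ⦅ 1# ⦆[ suc n , lam ] ∎)

  -- Uniqueness of Newton coefficients when positive integers can be cancelled.

  NatCancellative : Set (c ⊔ ℓ)
  NatCancellative = ∀ n x y → (suc n · 1#) * x ≈ (suc n · 1#) * y → x ≈ y

  -- Evaluating at 0 gives the constant terms; after removing them, (x)_{k+1} = x (x-1)_k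
  -- and cancellation of x = j+1 reduce to the shifted coefficient sequences.
  newton-unique : NatCancellative → ∀ n (d e : ℕ → Carrier) →
    (∀ j → sum {n} (λ i → d (toℕ i) * ⦅ j · 1# ⦆[ toℕ i , 1# ])
         ≈ sum {n} (λ i → e (toℕ i) * ⦅ j · 1# ⦆[ toℕ i , 1# ])) →
    ∀ (i : Fin n) → d (toℕ i) ≈ e (toℕ i)
  newton-unique cancel (suc n) d e d≈e = λ where
      zero    → d₀≈e₀
      (suc i) → newton-unique cancel n (d ∘ suc) (e ∘ suc) tails i
    where
    at-zero : ∀ f → sum {suc n} (λ i → f (toℕ i) * ⦅ 0# ⦆[ toℕ i , 1# ]) ≈ f 0
    at-zero f = begin
      f 0 * 1# + sum {n} (λ i → f (suc (toℕ i)) * ⦅ 0# ⦆[ suc (toℕ i) , 1# ])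
        ≈⟨ +-cong (*-identityʳ _) (sum-cong-≋ {n} λ i →
             trans (*-congˡ (falling-suc 0# (toℕ i))) (pull-out _ 0# _)) ⟩
      f 0 + sum {n} (λ i → 0# * (f (suc (toℕ i)) * ⦅ 0# - 1# ⦆[ toℕ i , 1# ]))
        ≈⟨ +-congˡ (*-distribˡ-sum {n} 0# (λ i → f (suc (toℕ i)) * ⦅ 0# - 1# ⦆[ toℕ i , 1# ])) ⟨
      f 0 + 0# * sum {n} (λ i → f (suc (toℕ i)) * ⦅ 0# - 1# ⦆[ toℕ i , 1# ])
        ≈⟨ trans (+-congˡ (zeroˡ _)) (+-identityʳ _) ⟩
      f 0 ∎

    d₀≈e₀ : d 0 ≈ e 0
    d₀≈e₀ = trans (sym (at-zero d)) (trans (d≈e 0) (at-zero e))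

    tail : (ℕ → Carrier) → ℕ → Carrier
    tail f j = sum {n} (λ i → f (suc (toℕ i)) * ⦅ j · 1# ⦆[ toℕ i , 1# ])

    at-suc : ∀ f j → sum {suc n} (λ i → f (toℕ i) * ⦅ suc j · 1# ⦆[ toℕ i , 1# ])
                   ≈ f 0 * 1# + (suc j · 1#) * tail f j
    at-suc f j = +-congˡ (begin
      sum {n} (λ i → f (suc (toℕ i)) * ⦅ suc j · 1# ⦆[ suc (toℕ i) , 1# ])
        ≈⟨ sum-cong-≋ {n} (λ i → trans
             (*-congˡ (trans (falling-suc _ (toℕ i)) (*-congˡ (falling-cong (toℕ i) 1# (xyx⁻¹≈y 1# (j · 1#))))))
             (pull-out _ _ _)) ⟩
      sum {n} (λ i → (suc j · 1#) * (f (suc (toℕ i)) * ⦅ j · 1# ⦆[ toℕ i , 1# ]))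
        ≈⟨ *-distribˡ-sum {n} (suc j · 1#) (λ i → f (suc (toℕ i)) * ⦅ j · 1# ⦆[ toℕ i , 1# ]) ⟨
      (suc j · 1#) * tail f j ∎)

    tails : ∀ j → tail d j ≈ tail e j
    tails j = cancel j _ _ (+-cancelˡ _ _ _ (begin
      d 0 * 1# + (suc j · 1#) * tail d j  ≈⟨ at-suc d j ⟨
      _                                   ≈⟨ d≈e (suc j) ⟩
      _                                   ≈⟨ at-suc e j ⟩
      e 0 * 1# + (suc j · 1#) * tail e j  ≈⟨ +-congʳ (*-congʳ d₀≈e₀) ⟨
      d 0 * 1# + (suc j · 1#) * tail e j  ∎))

  -- Both rows expand the same function (x)_{n,λ}, compared at the points `j · 1#`. The index stops
  -- at `n` because the defining relation leaves `S n k` free for k > n.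
  stirling-unique : NatCancellative → ∀ {lam} S → IsDegenerateStirling₂ lam S →
    ∀ n (i : Fin (suc n)) → S n (toℕ i) ≈ stirling lam n (toℕ i)
  stirling-unique cancel {lam} S isS n = newton-unique cancel (suc n) (S n) (stirling lam n) λ j →
    trans (sym (isS n (j · 1#))) (stirling-isDegenerateStirling₂ lam n (j · 1#))

  -- Rescaling by λ, and the identity over a ring.

  mult-inverse : ∀ {lam μ} → lam * μ ≈ 1# → ∀ k → lam * (k · μ) ≈ k · 1#
  mult-inverse           lam*μ≈1 zero    = zeroʳ _
  mult-inverse {lam} {μ} lam*μ≈1 (suc k) =
    trans (distribˡ lam μ (k · μ)) (+-cong lam*μ≈1 (mult-inverse lam*μ≈1 k))

  -- Each of the `k` factors absorbs one `lam`: λ(1 - jμ) = λ - j.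
  falling-rescale : ∀ {lam μ} → lam * μ ≈ 1# → ∀ k → ⦅ 1# ⦆[ k , μ ] * lam ^ k ≈ ⦅ lam ⦆[ k , 1# ]
  falling-rescale           lam*μ≈1 zero    = *-identityʳ 1#
  falling-rescale {lam} {μ} lam*μ≈1 (suc k) = trans (rescale _ (lam ^ k) lam (k · μ))
    (*-cong (falling-rescale lam*μ≈1 k) (+-congˡ (-‿cong (mult-inverse lam*μ≈1 k))))

  -- Here `n` is two less than the row index, so that the summation index k is i + 2 with `i`
  -- running from 0.
  stirling-sum : NatCancellative → ∀ {lam μ} S → lam * μ ≈ 1# → IsDegenerateStirling₂ lam S → ∀ n →
    ∑[ k from 2 to suc (suc n) ] (⦅ 1# ⦆[ k ℕ.∸ 1 , μ ] * lam ^ (k ℕ.∸ 2) * S (suc (suc n)) k)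
      ≈ (suc n · 1#) * ⦅ 1# ⦆[ suc n , lam ]
  stirling-sum cancel {lam} {μ} S lam*μ≈1 isS n = begin
    -- Each term has one power of λ fewer than `falling-rescale` needs. Inserting μλ = 1 supplies
    -- it, and the outer `μ` stays to be cancelled at the end.
    sum {suc n} (term ∘ toℕ)             ≈⟨ unit _ ⟩
    μ * (lam * sum {suc n} (term ∘ toℕ)) ≈⟨ *-congˡ (*-distribˡ-sum {suc n} lam (term ∘ toℕ)) ⟩
    μ * sum {suc n} (λ i → lam * term (toℕ i))
      ≈⟨ *-congˡ (sum-cong-≋ {suc n} λ i → trans (regroup _ _ lam _)
           (*-cong (stirling-unique cancel S isS (suc (suc n)) (suc (suc i)))
                   (falling-rescale lam*μ≈1 (suc (toℕ i))))) ⟩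
    μ * sum {suc n} (λ i → stirling lam (suc (suc n)) (suc (suc (toℕ i))) * ⦅ lam ⦆[ suc (toℕ i) , 1# ])
      ≈⟨ *-congˡ (stirling-tail lam n) ⟩
    μ * ((suc n · lam) * ⦅ 1# ⦆[ suc n , lam ])
      ≈⟨ *-assoc _ _ _ ⟨
    μ * (suc n · lam) * ⦅ 1# ⦆[ suc n , lam ]
      -- With `lam` and `μ` exchanged, `mult-inverse` cancels the outer `μ` against the λ in (n+1)λ.
      ≈⟨ *-congʳ (mult-inverse (trans (*-comm μ lam) lam*μ≈1) (suc n)) ⟩
    (suc n · 1#) * ⦅ 1# ⦆[ suc n , lam ] ∎
    where
    term : ℕ → Carrier
    term k = ⦅ 1# ⦆[ suc k , μ ] * lam ^ k * S (suc (suc n)) (suc (suc k))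

    unit : ∀ x → x ≈ μ * (lam * x)
    unit x = begin
      x               ≈⟨ *-identityˡ x ⟨
      1# * x          ≈⟨ *-congʳ lam*μ≈1 ⟨
      lam * μ * x     ≈⟨ trans (*-assoc lam μ x) (pull-out lam μ x) ⟩
      μ * (lam * x)   ∎

open import Defs
open import Data.Nat.Base using (ℕ; _≤_; _∸_)

open DegenerateProperties ℝ-commutativeRing using (NatCancellative; stirling-sum)

-- Cancelling positive integers in the reals.

seq-nat≥0 : ∀ n k → ℚ.0ℚ ℚ.≤ seq (n · 1ᴿ) k
seq-nat≥0 zero    k = ℚ.≤-refl
seq-nat≥0 (suc n) k = ℚ.+-mono-≤ (ℚ.nonNegative⁻¹ ℚ.1ℚ) (seq-nat≥0 n k)

-- Every term of the sequence is 1 plus a nonnegative rational, so the gap 1 is valid from index 0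
-- on. This is the witness that `inv` asks for.
suc#0 : ∀ n → suc n · 1ᴿ #ᴿ 0ᴿ
suc#0 n = mk# ℚ.1ℚ (ℚ.positive⁻¹ ℚ.1ℚ) 0 λ k _ →
  ≡.subst (ℚ.1ℚ ℚ.≤_)
    (≡.sym (≡.trans (≡.cong ℚ.∣_∣ (ℚ.+-identityʳ (seq (suc n · 1ᴿ) k)))
                    (ℚ.0≤p⇒∣p∣≡p (seq-nat≥0 (suc n) k))))
    (ℚ.+-monoʳ-≤ ℚ.1ℚ (seq-nat≥0 n k))

ℝ-natCancellative : NatCancellative
ℝ-natCancellative n x y nx≈ny = begin
  x              ≈⟨ unit x ⟨
  ν⁻¹ * (ν * x)  ≈⟨ *-congˡ nx≈ny ⟩
  ν⁻¹ * (ν * y)  ≈⟨ unit y ⟩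
  y              ∎
  where
  open CommutativeRing ℝ-commutativeRing
  open import Relation.Binary.Reasoning.Setoid setoid
  ν = suc n · 1ᴿ
  ν⁻¹ = inv ν (suc#0 n)

  unit : ∀ z → ν⁻¹ * (ν * z) ≈ z
  unit z = trans (sym (*-assoc ν⁻¹ ν z))
    (trans (*-congʳ (trans (*-comm ν⁻¹ ν) (*-inv ν (suc#0 n)))) (*-identityˡ z))

theorem15 : (lam : ℝ) (lam#0 : lam #ᴿ 0ᴿ) (S : ℕ → ℕ → ℝ) → IsDegenerateStirling₂ lam S →
    (n : ℕ) → 2 ≤ n →
    ∑[ k from 2 to n ] (⦅ 1ᴿ ⦆[ k ∸ 1 , inv lam lam#0 ] *ᴿ lam ^ (k ∸ 2) *ᴿ S n k)
    ≈ᴿ ((n ∸ 1) · 1ᴿ) *ᴿ ⦅ 1ᴿ ⦆[ n ∸ 1 , lam ]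
-- Once n is matched as a double successor, the truncated subtractions and the length of the sum
-- compute, and the goal is an instance of `stirling-sum`.
theorem15 lam lam#0 S isS (suc (suc n)) (s≤s (s≤s _)) =
  stirling-sum ℝ-natCancellative S (*-inv lam lam#0) isS n
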